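{- Let $G=(V,E)$ be a graph with $n\ge 4$ vertices and maximum degree $\Delta(G)=n-2$. If $|E|=m\ge 2n-4$, then $G$ is antimagic.
   Context: All graphs are finite, undirected and simple; $\Delta(G)$ denotes the maximum degree of $G$. An antimagic labeling of a graph with $m$ edges and $n$ vertices is a bijection from the set of edges to the integers $\{1,\ldots,m\}$ such that all $n$ vertex sums are pairwise distinct, where a vertex sum is the sum of the labels of all edges incident with that vertex (an isolated vertex has vertex sum $0$). A graph is called antimagic if it has an antimagic labeling. -}

module Defs where

open import Data.Fin.Base using (Fin; toℕ)
open import Data.Fin.Properties using (_<?_)
open import Data.Nat.Base using (ℕ; suc; _⊔_)
open import Data.Nat.Properties using (+-0-commutativeMonoid)
open import Data.Product.Base using (Σ; _×_; _,_)
open import Data.Sum.Base using (_⊎_; inj₁; inj₂)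
open import Data.Vec.Functional using (foldr)
open import Function.Bundles using (Bijection)
open import Function.Definitions using (Injective)
open import Level using (0ℓ)
open import Relation.Binary.Bundles using (Setoid)
open import Relation.Binary.Core using (Rel)
open import Relation.Binary.Definitions using (Decidable; Irreflexive; Symmetric)
open import Relation.Binary.PropositionalEquality using (_≡_; refl; setoid)
open import Relation.Nullary.Decidable using (Dec; yes; no; _×-dec_)

open import Algebra.Properties.CommutativeMonoid.Sum +-0-commutativeMonoid
  using (sum-syntax)

-- A finite simple undirected graph on the vertex set Fin n.
record Graph (n : ℕ) : Set₁ where
  field
    Adj    : Rel (Fin n) 0ℓ
    adj?   : Decidable Adj
    sym    : Symmetric Adj
    irrefl : Irreflexive _≡_ Adj

𝟙 : ∀ {p} {P : Set p} → Dec P → ℕ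
𝟙 (yes _) = 1
𝟙 (no  _) = 0

module _ {n : ℕ} (G : Graph n) where
  open Graph G

  degree : Fin n → ℕ
  degree v = ∑[ w < n ] 𝟙 (adj? v w)

  maxDegree : ℕ
  maxDegree = foldr _⊔_ 0 degree

  -- Each edge {i , j} is counted once, through its ordering i < j.
  size : ℕ
  size = ∑[ i < n ] ∑[ j < n ] 𝟙 (i <? j ×-dec adj? i j)

  record Dart : Set where
    constructor dart
    field
      src tgt  : Fin n
      adjacent : Adj src tgt

  open Dart

  SameEdge : Rel Dart 0ℓ
  SameEdge d e = (src d ≡ src e × tgt d ≡ tgt e) ⊎ (src d ≡ tgt e × tgt d ≡ src e)

  -- The edge set of G: ordered pairs of adjacent vertices, with (u , v)
  -- identified with (v , u), and irrespective of the adjacency proof.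
  edgeSetoid : Setoid 0ℓ 0ℓ
  edgeSetoid = record
    { Carrier       = Dart
    ; _≈_           = SameEdge
    ; isEquivalence = record
      { refl  = inj₁ (refl , refl)
      ; sym   = λ where
          (inj₁ (refl , refl)) → inj₁ (refl , refl)
          (inj₂ (refl , refl)) → inj₂ (refl , refl)
      ; trans = λ where
          (inj₁ (refl , refl)) q                    → q
          (inj₂ (refl , refl)) (inj₁ (refl , refl)) → inj₂ (refl , refl)
          (inj₂ (refl , refl)) (inj₂ (refl , refl)) → inj₁ (refl , refl)
      }
    }

  -- The label set {1, …, m} is represented by Fin m, with k : Fin m
  -- standing for the integer suc (toℕ k); see label.
  Labeling : Set
  Labeling = Bijection edgeSetoid (setoid (Fin size))

  label : Labeling → Dart → ℕ
  label f e = suc (toℕ (Bijection.to f e))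

  contribution : Labeling → ∀ {v w} → Dec (Adj v w) → ℕ
  contribution f (yes vw) = label f (dart _ _ vw)
  contribution f (no  _)  = 0

  -- As G is simple, the edges incident with v correspond to the neighbours
  -- of v, so the vertex sum runs over all w and non-neighbours contribute 0.
  vertexSum : Labeling → Fin n → ℕ
  vertexSum f v = ∑[ w < n ] contribution f (adj? v w)

  IsAntimagicLabeling : Labeling → Set
  IsAntimagicLabeling f = Injective _≡_ _≡_ (vertexSum f)

  Antimagic : Set
  Antimagic = Σ Labeling IsAntimagicLabeling

{-# OPTIONS --safe #-}

-- Let v have degree n - 2 and let x be its only non-neighbour. Reserve the n - 1 largest labels for the
-- edges at v and one edge xy at x, and label all other edges arbitrarily. Then every vertex u ≠ v has its
-- own reserved edge (uv, or xy for u = x), and if the reserved labels increase with the partial sums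
-- then the sums of all u ≠ v are distinct. The only obstruction is that the partial sum of y includes the
-- reserved label of xy, which depends on the position of x and hence on whether y precedes x; this is
-- settled by comparing the partial sum of x with that of y for the smaller of the two possible labels.
-- The sum of v differs from the others because its labels are too large. If x has degree at most 1, the
-- edges at v alone are reserved, and the sum of x is then the smallest.

module Submission where

open import Defs
open import Data.Nat.Base using (ℕ; _≥_; _*_; _∸_)
open import Relation.Binary.PropositionalEquality using (_≡_)

open import Data.Fin.Base as Fin
  using (Fin; zero; suc; toℕ; fromℕ<; cast; join; punchIn; punchOut; splitAt; _↑ˡ_; _↑ʳ_)
open import Data.Fin.Permutation.Components using (transpose; transpose-inverse)
open import Data.Fin.Properties as Fin using (_≟_; splitAt-↑ˡ; splitAt-↑ʳ; splitAt⁻¹-↑ˡ; splitAt⁻¹-↑ʳ)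
open import Data.Nat.Base hiding (ℕ; _≥_; _*_; _∸_)
open import Data.Nat.Properties as ℕ hiding (_≟_; suc-injective)
open import Data.Nat.Tactic.RingSolver using (solve-∀)
open import Data.Product.Base using (Σ; ∃; _×_; _,_; proj₁; proj₂)
open import Data.Product.Properties using (,-injectiveˡ)
open import Data.Sum.Base using (_⊎_; inj₁; inj₂; [_,_]′; map₂)
open import Data.Sum.Properties using (inj₂-injective)
open import Data.Vec.Functional using (_∷_; foldr)
open import Function.Base using (_∘_; const; _∋_)
open import Function.Definitions using (Injective)
open import Relation.Binary.Bundles using (Setoid)
open import Relation.Binary.Definitions using (tri<; tri≈; tri>)
open import Relation.Binary.PropositionalEquality hiding (_≡_)
open import Relation.Nullary using (¬_; Dec; yes; no; contradiction; ¬?; _×-dec_)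
open import Relation.Nullary.Decidable using (dec-true; dec-false; decidable-stable)

open import Algebra.Properties.Semiring.Sum +-*-semiring
  using (sum; sum-syntax; sum-remove; sum-cong-≗; sum-replicate-zero; ∑-comm; ∑-distrib-+; *-distribʳ-sum)

𝟙-true : ∀ {p} {P : Set p} (P? : Dec P) → P → 𝟙 P? ≡ 1
𝟙-true (yes _) _ = refl
𝟙-true (no ¬p) p = contradiction p ¬p

𝟙-false : ∀ {p} {P : Set p} (P? : Dec P) → ¬ P → 𝟙 P? ≡ 0
𝟙-false (yes p) ¬p = contradiction p ¬p
𝟙-false (no _)  _  = refl

𝟙-witness : ∀ {p} {P : Set p} (P? : Dec P) → 1 ≤ 𝟙 P? → P
𝟙-witness (yes p) _ = p

𝟙-≤1 : ∀ {p} {P : Set p} (P? : Dec P) → 𝟙 P? ≤ 1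
𝟙-≤1 (yes _) = ≤-refl
𝟙-≤1 (no _)  = z≤n

𝟙-mono : ∀ {p q} {P : Set p} {Q : Set q} (P? : Dec P) (Q? : Dec Q) → (P → Q) → 𝟙 P? ≤ 𝟙 Q?
𝟙-mono (yes p) Q? f = ≤-reflexive (sym (𝟙-true Q? (f p)))
𝟙-mono (no _)  Q? f = z≤n

sum-mono : ∀ {n} {f g : Fin n → ℕ} → (∀ i → f i ≤ g i) → sum f ≤ sum g
sum-mono {zero}  h = z≤n
sum-mono {suc n} h = +-mono-≤ (h zero) (sum-mono (h ∘ suc))

sum-const : ∀ n c → sum {n} (const c) ≡ n * c
sum-const zero    c = refl
sum-const (suc n) c = cong (c +_) (sum-const n c)

sum-zero : ∀ {n} {f : Fin n → ℕ} → (∀ i → f i ≡ 0) → sum f ≡ 0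
sum-zero {n} h = trans (sum-cong-≗ h) (sum-replicate-zero n)

sum-single : ∀ {n} {f : Fin n → ℕ} i → (∀ j → j ≢ i → f j ≡ 0) → sum f ≡ f i
sum-single {suc n} {f} i h = begin
  sum f                       ≡⟨ sum-remove {i = i} f ⟩
  f i + sum (f ∘ punchIn i)   ≡⟨ cong (f i +_) (sum-zero λ j → h _ (Fin.punchInᵢ≢i i j)) ⟩
  f i + 0                     ≡⟨ +-identityʳ _ ⟩
  f i                         ∎
  where open ≡-Reasoning


sum-pos : ∀ {n} (f : Fin n → ℕ) → 1 ≤ sum f → ∃ λ i → 1 ≤ f i
sum-pos {suc n} f h with f zero in eq
... | suc _ = zero , subst (1 ≤_) (sym eq) (s≤s z≤n)
... | zero  with sum-pos (f ∘ suc) h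
...   | i , 1≤fi = suc i , 1≤fi

injective⇒surjective : ∀ {n} {f : Fin n → Fin n} → Injective _≡_ _≡_ f → ∀ y → ∃ λ x → f x ≡ y
injective⇒surjective {suc n} {f} inj y with Fin.any? (λ x → f x ≟ y)
... | yes p = p
... | no ¬p = contradiction (Fin.injective⇒≤ g-inj) 1+n≰n
  where
  y≢f : ∀ x → y ≢ f x
  y≢f x y≡fx = ¬p (x , sym y≡fx)
  g-inj : Injective _≡_ _≡_ (λ x → punchOut (y≢f x))
  g-inj eq = inj (Fin.punchOut-injective (y≢f _) (y≢f _) eq)

sum-injective-≥ : ∀ {n} (p : Fin (suc n) → ℕ) → Injective _≡_ _≡_ p → n ≤ sum p
sum-injective-≥ {n} p inj with Fin.any? (λ i → p i ℕ.≟ 0)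
... | yes (i , pi≡0) = begin
  n                          ≡⟨ *-identityʳ n ⟨
  n * 1                      ≡⟨ sum-const n 1 ⟨
  sum {n} (const 1)          ≤⟨ sum-mono (λ j → n≢0⇒n>0 λ pj≡0 → Fin.punchInᵢ≢i i j (inj (trans pj≡0 (sym pi≡0)))) ⟩
  sum (p ∘ punchIn i)        ≤⟨ m≤n+m _ (p i) ⟩
  p i + sum (p ∘ punchIn i)  ≡⟨ sum-remove {i = i} p ⟨
  sum p                      ∎
  where open ≤-Reasoning
... | no ¬0 = begin
  n                          ≤⟨ n≤1+n n ⟩
  suc n                      ≡⟨ *-identityʳ (suc n) ⟨
  suc n * 1                  ≡⟨ sum-const (suc n) 1 ⟨
  sum {suc n} (const 1)      ≤⟨ sum-mono (λ j → n≢0⇒n>0 λ pj≡0 → ¬0 (j , pj≡0)) ⟩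
  sum p                      ∎
  where open ≤-Reasoning

-- Ranks

-- Of two indices with the same q, the larger one gets the smaller rank.
rank : ∀ {r} → (Fin r → ℕ) → Fin r → ℕ
rank {suc r} q zero    = ∑[ j < r ] 𝟙 (q (suc j) ≤? q zero)
rank {suc r} q (suc i) = 𝟙 (q zero <? q (suc i)) + rank (q ∘ suc) i

count≤ : ∀ {r} → (Fin r → ℕ) → ℕ → ℕ
count≤ {r} q y = ∑[ j < r ] 𝟙 (q j ≤? y)

count≤-mono : ∀ {r} (q : Fin r → ℕ) {y z} → y ≤ z → count≤ q y ≤ count≤ q z
count≤-mono q {y} {z} y≤z = sum-mono λ j → 𝟙-mono (q j ≤? y) (q j ≤? z) (λ h → ≤-trans h y≤z)

rank<count≤ : ∀ {r} (q : Fin r → ℕ) i {y} → q i ≤ y → rank q i < count≤ q y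
rank<count≤ {suc r} q zero {y} qi≤y rewrite 𝟙-true (q zero ≤? y) qi≤y = s≤s (count≤-mono (q ∘ suc) qi≤y)
rank<count≤ {suc r} q (suc i) {y} qi≤y =
  +-mono-≤-< (𝟙-mono (q zero <? q (suc i)) (q zero ≤? y) (λ h → ≤-trans (<⇒≤ h) qi≤y)) (rank<count≤ (q ∘ suc) i qi≤y)

count≤≤rank : ∀ {r} (q : Fin r → ℕ) i {y} → y < q i → count≤ q y ≤ rank q i
count≤≤rank {suc r} q zero {y} y<qi rewrite 𝟙-false (q zero ≤? y) (<⇒≱ y<qi) = count≤-mono (q ∘ suc) (<⇒≤ y<qi)
count≤≤rank {suc r} q (suc i) {y} y<qi =
  +-mono-≤ (𝟙-mono (q zero ≤? y) (q zero <? q (suc i)) (λ h → ≤-<-trans h y<qi)) (count≤≤rank (q ∘ suc) i y<qi)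

rank-mono-< : ∀ {r} (q : Fin r → ℕ) i j → q i < q j → rank q i < rank q j
rank-mono-< q zero    zero    h = contradiction h (<-irrefl refl)
rank-mono-< q zero    (suc j) h rewrite 𝟙-true (q zero <? q (suc j)) h = s≤s (count≤≤rank (q ∘ suc) j h)
rank-mono-< q (suc i) zero  h rewrite 𝟙-false (q zero <? q (suc i)) (<⇒≯ h) = rank<count≤ (q ∘ suc) i (<⇒≤ h)
rank-mono-< q (suc i) (suc j) h =
  +-mono-≤-< (𝟙-mono (q zero <? q (suc i)) (q zero <? q (suc j)) (λ h′ → <-trans h′ h)) (rank-mono-< (q ∘ suc) i j h)

rank-tie : ∀ {r} (q : Fin r → ℕ) i j → q i ≡ q j → j Fin.< i → rank q i < rank q j
rank-tie q (suc i) zero  h _ rewrite 𝟙-false (q zero <? q (suc i)) (≤⇒≯ (≤-reflexive h)) =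
  rank<count≤ (q ∘ suc) i (≤-reflexive h)
rank-tie q (suc i) (suc j) h (s≤s j<i) rewrite h = +-monoʳ-< (𝟙 (q zero <? q (suc j))) (rank-tie (q ∘ suc) i j h j<i)

rank< : ∀ {r} (q : Fin r → ℕ) i → rank q i < r
rank< {r} q i = begin-strict
  rank q i                       <⟨ rank<count≤ q i ≤-refl ⟩
  count≤ q (q i)                 ≤⟨ sum-mono (λ j → 𝟙-≤1 (q j ≤? q i)) ⟩
  sum {r} (const 1)              ≡⟨ sum-const r 1 ⟩
  r * 1                          ≡⟨ *-identityʳ r ⟩
  r                              ∎
  where open ≤-Reasoning

rank-compare : ∀ {r} (q : Fin r → ℕ) {i j} → i ≢ j →
               (q i ≤ q j × rank q i < rank q j) ⊎ (q j ≤ q i × rank q j < rank q i)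
rank-compare q {i} {j} i≢j with <-cmp (q i) (q j)
... | tri< lt _ _ = inj₁ (<⇒≤ lt , rank-mono-< q i j lt)
... | tri> _ _ gt = inj₂ (<⇒≤ gt , rank-mono-< q j i gt)
... | tri≈ _ eq _ with Fin.<-cmp i j
...   | tri< lt _ _ = inj₂ (≤-reflexive (sym eq) , rank-tie q j i (sym eq) lt)
...   | tri≈ _ i≡j _ = contradiction i≡j i≢j
...   | tri> _ _ gt = inj₁ (≤-reflexive eq , rank-tie q i j eq gt)

rank-injective : ∀ {r} (q : Fin r → ℕ) → Injective _≡_ _≡_ (rank q)
rank-injective q {i} {j} eq with i ≟ j
... | yes i≡j = i≡j
... | no i≢j with rank-compare q i≢j
...   | inj₁ (_ , lt) = contradiction eq (<⇒≢ lt)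
...   | inj₂ (_ , lt) = contradiction (sym eq) (<⇒≢ lt)

-- Edges and labelings

pack : ∀ {n} (f : Fin n → ℕ) → Σ (Fin n) (Fin ∘ f) → Fin (sum f)
pack f (zero  , c) = c ↑ˡ _
pack f (suc i , c) = f zero ↑ʳ pack (f ∘ suc) (i , c)

unpack : ∀ {n} (f : Fin n → ℕ) → Fin (sum f) → Σ (Fin n) (Fin ∘ f)
unpack {suc n} f k with splitAt (f zero) k
... | inj₁ c = zero , c
... | inj₂ l = let i , c = unpack (f ∘ suc) l in suc i , c

unpack-pack : ∀ {n} (f : Fin n → ℕ) s → unpack f (pack f s) ≡ s
unpack-pack f (zero  , c) rewrite splitAt-↑ˡ (f zero) c (sum (f ∘ suc)) = refl
unpack-pack f (suc i , c)
  rewrite splitAt-↑ʳ (f zero) (sum (f ∘ suc)) (pack (f ∘ suc) (i , c)) | unpack-pack (f ∘ suc) (i , c) = refl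

pack-unpack : ∀ {n} (f : Fin n → ℕ) k → pack f (unpack f k) ≡ k
pack-unpack {suc n} f k with splitAt (f zero) k in eq
... | inj₁ c = splitAt⁻¹-↑ˡ eq
... | inj₂ l = trans (cong (f zero ↑ʳ_) (pack-unpack (f ∘ suc) l)) (splitAt⁻¹-↑ʳ eq)

pack-injective : ∀ {n} (f : Fin n → ℕ) → Injective _≡_ _≡_ (pack f)
pack-injective f {s} {s′} eq = trans (sym (unpack-pack f s)) (trans (cong (unpack f) eq) (unpack-pack f s′))

𝟙-proof : ∀ {p} {P : Set p} (P? : Dec P) → Fin (𝟙 P?) → P
𝟙-proof (yes p) _ = p

𝟙-element : ∀ {p} {P : Set p} (P? : Dec P) → P → Fin (𝟙 P?)
𝟙-element (yes _) _ = zero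
𝟙-element (no ¬p) p = contradiction p ¬p

𝟙-unique : ∀ {p} {P : Set p} (P? : Dec P) (c d : Fin (𝟙 P?)) → c ≡ d
𝟙-unique (yes _) zero zero = refl

extend-injection : ∀ {r M} (a b : Fin r → Fin M) → Injective _≡_ _≡_ a → Injective _≡_ _≡_ b →
                   Σ (Fin M → Fin M) λ φ → Injective _≡_ _≡_ φ × (∀ i → φ (a i) ≡ b i)
extend-injection {zero}      a b a-inj b-inj = (λ k → k) , (λ eq → eq) , λ ()
extend-injection {suc r} {M} a b a-inj b-inj =
  ψ ∘ φ , (λ eq → φ-inj (ψ-inj eq)) , maps
  where
  tail-extension = extend-injection (a ∘ suc) (b ∘ suc) (Fin.suc-injective ∘ a-inj) (Fin.suc-injective ∘ b-inj)
  φ = proj₁ tail-extension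
  φ-inj = proj₁ (proj₂ tail-extension)
  φ-maps = proj₂ (proj₂ tail-extension)
  p = φ (a zero)
  q = b zero
  ψ : Fin M → Fin M
  ψ = transpose p q
  ψ-inj : Injective _≡_ _≡_ ψ
  ψ-inj {i} {j} eq = trans (sym (transpose-inverse q p)) (trans (cong (transpose q p) eq) (transpose-inverse q p))
  maps : ∀ i → ψ (φ (a i)) ≡ b i
  maps zero    rewrite dec-true (p ≟ p) refl = refl
  maps (suc i)
    rewrite φ-maps i
          | dec-false (b (suc i) ≟ p) (λ eq → Fin.0≢1+n (a-inj (φ-inj (trans (sym eq) (sym (φ-maps i))))))
          | dec-false (b (suc i) ≟ q) (λ eq → Fin.0≢1+n (sym (b-inj eq))) = refl

module _ {n : ℕ} (G : Graph n) where
  open Graph G renaming (sym to Adj-sym)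
  open Dart

  private
    _≈_ = SameEdge G

  edge? : ∀ i j → Dec (i Fin.< j × Adj i j)
  edge? i j = i Fin.<? j ×-dec adj? i j

  Slot : Set
  Slot = Σ (Fin n) λ i → Σ (Fin n) λ j → Fin (𝟙 (edge? i j))

  slot-edge : (s : Slot) → proj₁ s Fin.< proj₁ (proj₂ s) × Adj (proj₁ s) (proj₁ (proj₂ s))
  slot-edge (i , j , c) = 𝟙-proof (edge? i j) c

  slot : Dart G → Slot
  slot (dart u w uw) with Fin.<-cmp u w
  ... | tri< u<w _ _ = u , w , 𝟙-element (edge? u w) (u<w , uw)
  ... | tri≈ _ u≡w _ = contradiction uw (irrefl u≡w)
  ... | tri> _ _ w<u = w , u , 𝟙-element (edge? w u) (w<u , Adj-sym uw)

  slotDart : Slot → Dart G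
  slotDart s = dart _ _ (proj₂ (slot-edge s))

  slotDart-slot : ∀ d → slotDart (slot d) ≈ d
  slotDart-slot (dart u w uw) with Fin.<-cmp u w
  ... | tri< _ _ _ = inj₁ (refl , refl)
  ... | tri≈ _ u≡w _ = contradiction uw (irrefl u≡w)
  ... | tri> _ _ _ = inj₂ (refl , refl)

  slotDart-injective : ∀ s s′ → slotDart s ≈ slotDart s′ → s ≡ s′
  slotDart-injective (i , j , c) (i , j , c′) (inj₁ (refl , refl)) = cong (λ c → i , j , c) (𝟙-unique (edge? i j) c c′)
  slotDart-injective s s′ (inj₂ (refl , refl)) =
    contradiction (proj₁ (slot-edge s′)) (Fin.<-asym {x = proj₁ s} (proj₁ (slot-edge s)))

  slotIndex : Slot → Fin (size G)
  slotIndex (i , s) = pack (λ i → ∑[ j < n ] 𝟙 (edge? i j)) (i , pack (λ j → 𝟙 (edge? i j)) s)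

  slotIndex-injective : ∀ s s′ → slotIndex s ≡ slotIndex s′ → s ≡ s′
  slotIndex-injective (i , s) (i′ , s′) eq with pack-injective (λ i → ∑[ j < n ] 𝟙 (edge? i j)) {i , _} {i′ , _} eq
  ... | eq′ with ,-injectiveˡ eq′
  ...   | refl = cong (i ,_) (pack-injective (λ j → 𝟙 (edge? i j)) (lemma eq′))
    where
    lemma : ∀ {x y} → (Σ (Fin n) (λ i → Fin (∑[ j < n ] 𝟙 (edge? i j))) ∋ (i , x)) ≡ (i , y) → x ≡ y
    lemma refl = refl

  slotIndex-surjective : ∀ k → ∃ λ s → slotIndex s ≡ k
  slotIndex-surjective k = (proj₁ s , unpack (λ j → 𝟙 (edge? (proj₁ s) j)) (proj₂ s)) ,
    trans (cong (λ c → pack f (proj₁ s , c)) (pack-unpack (λ j → 𝟙 (edge? (proj₁ s) j)) (proj₂ s))) (pack-unpack f k)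
    where
    f = λ i → ∑[ j < n ] 𝟙 (edge? i j)
    s = unpack f k

  private module E = Setoid (edgeSetoid G)

  index : Dart G → Fin (size G)
  index = slotIndex ∘ slot

  index-cong : ∀ d e → d ≈ e → index d ≡ index e
  index-cong d e d≈e = cong slotIndex (slotDart-injective (slot d) (slot e)
    (E.trans {slotDart (slot d)} {d} {slotDart (slot e)} (slotDart-slot d)
      (E.trans {d} {e} {slotDart (slot e)} d≈e (E.sym {slotDart (slot e)} {e} (slotDart-slot e)))))

  index-injective : ∀ d e → index d ≡ index e → d ≈ e
  index-injective d e eq with slotIndex-injective (slot d) (slot e) eq
  ... | slots≡ = E.trans {d} {slotDart (slot d)} {e} (E.sym {slotDart (slot d)} {d} (slotDart-slot d))
      (subst (λ s → slotDart s ≈ e) (sym slots≡) (slotDart-slot e))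

  index-surjective : ∀ k → ∃ λ d → index d ≡ k
  index-surjective k = let s , eq = slotIndex-surjective k in
    slotDart s , trans (cong slotIndex (slotDart-injective (slot (slotDart s)) s (slotDart-slot (slotDart s)))) eq

  labelBy : (g : Dart G → Fin (size G)) → (∀ d e → d ≈ e → g d ≡ g e) → (∀ d e → g d ≡ g e → d ≈ e) → Labeling G
  labelBy g g-cong g-inj = record
    { to        = g
    ; cong      = λ {d} {e} → g-cong d e
    ; bijective = (λ {d} {e} → g-inj d e) , λ k →
        let l , eq = injective⇒surjective g∘enum-injective k
        in enum l , λ {d} d≈ → trans (g-cong d (enum l) d≈) eq
    }
    where
    enum : Fin (size G) → Dart G
    enum k = proj₁ (index-surjective k)
    g∘enum-injective : Injective _≡_ _≡_ (g ∘ enum)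
    g∘enum-injective {k} {l} eq = trans (sym (proj₂ (index-surjective k)))
      (trans (index-cong (enum k) (enum l) (g-inj (enum k) (enum l) eq)) (proj₂ (index-surjective l)))

-- Reserved labels

module _ {n : ℕ} (G : Graph n) where
  open Graph G using (Adj; adj?; irrefl)
  open Dart

  hits : Dart G → Fin n → Fin n → ℕ
  hits d u w = 𝟙 (src d ≟ u) * 𝟙 (tgt d ≟ w) + 𝟙 (src d ≟ w) * 𝟙 (tgt d ≟ u)

  𝟙*𝟙-false : ∀ {a b c d : Fin n} → ¬ (a ≡ b × c ≡ d) → 𝟙 (a ≟ b) * 𝟙 (c ≟ d) ≡ 0
  𝟙*𝟙-false {a} {b} {c} {d} h with a ≟ b | c ≟ d
  ... | yes p | yes q = contradiction (p , q) h
  ... | yes _ | no  _ = refl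
  ... | no  _ | _     = refl

  hits-0 : ∀ d u w → ¬ (src d ≡ u × tgt d ≡ w) → ¬ (src d ≡ w × tgt d ≡ u) → hits d u w ≡ 0
  hits-0 d u w h h′ = cong₂ _+_ (𝟙*𝟙-false h) (𝟙*𝟙-false h′)

  hits-1 : ∀ d e → SameEdge G d e → hits e (src d) (tgt d) ≡ 1
  hits-1 d (dart u w uw) (inj₁ (refl , refl))
    rewrite 𝟙-true (u ≟ u) refl | 𝟙-true (w ≟ w) refl
    = cong suc (𝟙*𝟙-false λ (u≡w , _) → irrefl u≡w uw)
  hits-1 d (dart u w uw) (inj₂ (refl , refl))
    rewrite 𝟙-true (u ≟ u) refl | 𝟙-true (w ≟ w) refl
    = cong (_+ 1) (𝟙*𝟙-false {u} {w} {w} {u} λ (u≡w , _) → irrefl u≡w uw)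

  ∑-hits : ∀ d u → ∑[ w < n ] hits d u w ≡ 𝟙 (src d ≟ u) + 𝟙 (tgt d ≟ u)
  ∑-hits d u = begin
    ∑[ w < n ] hits d u w                               ≡⟨ ∑-distrib-+ (λ w → 𝟙 (src d ≟ u) * 𝟙 (tgt d ≟ w)) _ ⟩
    ∑[ w < n ] (𝟙 (src d ≟ u) * 𝟙 (tgt d ≟ w)) +
    ∑[ w < n ] (𝟙 (src d ≟ w) * 𝟙 (tgt d ≟ u))          ≡⟨ cong₂ _+_
        (sum-single (tgt d) λ w w≢ → trans (cong (𝟙 (src d ≟ u) *_) (𝟙-false (tgt d ≟ w) (w≢ ∘ sym)))
          (*-zeroʳ (𝟙 (src d ≟ u))))
        (sum-single (src d) λ w w≢ → cong (_* 𝟙 (tgt d ≟ u)) (𝟙-false (src d ≟ w) (w≢ ∘ sym))) ⟩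
    𝟙 (src d ≟ u) * 𝟙 (tgt d ≟ tgt d) + 𝟙 (src d ≟ src d) * 𝟙 (tgt d ≟ u) ≡⟨ cong₂ _+_
        (trans (cong (𝟙 (src d ≟ u) *_) (𝟙-true (tgt d ≟ tgt d) refl)) (*-identityʳ _))
        (trans (cong (_* 𝟙 (tgt d ≟ u)) (𝟙-true (src d ≟ src d) refl)) (*-identityˡ _)) ⟩
    𝟙 (src d ≟ u) + 𝟙 (tgt d ≟ u)                       ∎
    where open ≡-Reasoning

  incidenceSum : ∀ {r} → (Fin r → Dart G) → (Fin r → ℕ) → Fin n → ℕ
  incidenceSum {r} e x u = ∑[ i < r ] ((𝟙 (src (e i) ≟ u) + 𝟙 (tgt (e i) ≟ u)) * x i)

  -- Reserve the b + 1, …, b + r largest labels for r given edges. The other edges, labelled once and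
  -- for all, contribute t to the vertex sums, whereas the reserved labels can still be permuted at will.
  record Reservation {r} (e : Fin r → Dart G) : Set where
    field
      b       : ℕ
      t       : Fin n → ℕ
      t-bound : ∀ u → t u + incidenceSum e (const b) u ≤ degree G u * b
      relabel : (p : Fin r → Fin r) → Injective _≡_ _≡_ p → Σ (Labeling G) λ f →
                ∀ u → vertexSum G f u ≡ t u + incidenceSum e (λ i → suc (b + toℕ (p i))) u

  cast-injective : ∀ {m n} (eq : m ≡ n) → Injective _≡_ _≡_ (cast eq)
  cast-injective refl {i} {j} h = trans (sym (Fin.cast-is-id refl i)) (trans h (Fin.cast-is-id refl j))

  module Reserve
    {r b : ℕ} (size≡ : size G ≡ b + r)
    (e : Fin r → Dart G) (e-injective : ∀ i j → SameEdge G (e i) (e j) → i ≡ j)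
    (place : Dart G → Fin (b + r))
    (place-cong : ∀ d d′ → SameEdge G d d′ → place d ≡ place d′)
    (place-injective : ∀ d d′ → place d ≡ place d′ → SameEdge G d d′)
    (place-e : ∀ i → place (e i) ≡ b ↑ʳ i)
    where

    low : Dart G → ℕ
    low d = [ (λ c → suc (toℕ c)) , const 0 ]′ (splitAt b (place d))

    lowAt : ∀ {u w} → Dec (Adj u w) → ℕ
    lowAt (yes uw) = low (dart _ _ uw)
    lowAt (no _)   = 0

    hitSum : (Fin r → ℕ) → Fin n → Fin n → ℕ
    hitSum x u w = ∑[ i < r ] (hits (e i) u w * x i)

    hitSum-miss : ∀ x d → (∀ i → ¬ SameEdge G d (e i)) → hitSum x (src d) (tgt d) ≡ 0
    hitSum-miss x d miss = sum-zero λ i → cong (_* x i)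
      (hits-0 (e i) (src d) (tgt d) (λ (p , q) → miss i (inj₁ (sym p , sym q)))
        (λ (p , q) → miss i (inj₂ (sym q , sym p))))

    hitSum-hit : ∀ x d i → SameEdge G d (e i) → hitSum x (src d) (tgt d) ≡ x i
    hitSum-hit x d i same = trans (sum-single i others) (trans (cong (_* x i) (hits-1 d (e i) same)) (*-identityˡ (x i)))
      where
      clash : ∀ j → j ≢ i → ¬ SameEdge G d (e j)
      clash j j≢i same′ = j≢i (e-injective j i (E.trans {e j} {d} {e i} (E.sym {d} {e j} same′) same))
        where module E = Setoid (edgeSetoid G)
      others : ∀ j → j ≢ i → hits (e j) (src d) (tgt d) * x j ≡ 0
      others j j≢i = cong (_* x j) (hits-0 (e j) (src d) (tgt d)
        (λ (p , q) → clash j j≢i (inj₁ (sym p , sym q))) (λ (p , q) → clash j j≢i (inj₂ (sym q , sym p))))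

    hitSum-nonadjacent : ∀ x u w → ¬ Adj u w → hitSum x u w ≡ 0
    hitSum-nonadjacent x u w ¬uw = sum-zero λ i → cong (_* x i) (hits-0 (e i) u w
      (λ { (refl , refl) → ¬uw (adjacent (e i)) }) (λ { (refl , refl) → ¬uw (Graph.sym G (adjacent (e i))) }))

    hitSum-low : ∀ x d c → splitAt b (place d) ≡ inj₁ c → hitSum x (src d) (tgt d) ≡ 0
    hitSum-low x d c eq = hitSum-miss x d λ i same →
      contradiction
        (trans (sym eq) (trans (cong (splitAt b) (trans (place-cong d (e i) same) (place-e i))) (splitAt-↑ʳ b r i)))
        λ ()

    hitSum-high : ∀ x d i → splitAt b (place d) ≡ inj₂ i → hitSum x (src d) (tgt d) ≡ x i
    hitSum-high x d i eq = hitSum-hit x d i (place-injective d (e i) (trans (sym (splitAt⁻¹-↑ʳ eq)) (sym (place-e i))))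

    ∑-hitSum : ∀ x u → ∑[ w < n ] hitSum x u w ≡ incidenceSum e x u
    ∑-hitSum x u = begin
      ∑[ w < n ] ∑[ i < r ] (hits (e i) u w * x i)   ≡⟨ ∑-comm (λ w i → hits (e i) u w * x i) ⟩
      ∑[ i < r ] ∑[ w < n ] (hits (e i) u w * x i)   ≡⟨ sum-cong-≗ (λ i → *-distribʳ-sum (x i) (λ w → hits (e i) u w)) ⟨
      ∑[ i < r ] (∑[ w < n ] hits (e i) u w * x i)   ≡⟨ sum-cong-≗ (λ i → cong (_* x i) (∑-hits (e i) u)) ⟩
      incidenceSum e x u                              ∎
      where open ≡-Reasoning

    lowSum : Fin n → ℕ
    lowSum u = ∑[ w < n ] lowAt (adj? u w)

    lowAt-bound : ∀ u w → lowAt (adj? u w) + hitSum (const b) u w ≤ 𝟙 (adj? u w) * b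
    lowAt-bound u w with adj? u w
    ... | no ¬uw = ≤-reflexive (hitSum-nonadjacent (const b) u w ¬uw)
    ... | yes uw with splitAt b (place (dart u w uw)) in eq
    ...   | inj₁ c rewrite hitSum-low (const b) (dart u w uw) c eq | +-identityʳ (toℕ c) | *-identityˡ b = Fin.toℕ<n c
    ...   | inj₂ i rewrite hitSum-high (const b) (dart u w uw) i eq | *-identityˡ b = ≤-refl

    lowSum-bound : ∀ u → lowSum u + incidenceSum e (const b) u ≤ degree G u * b
    lowSum-bound u = begin
      lowSum u + incidenceSum e (const b) u                        ≡⟨ cong (lowSum u +_) (∑-hitSum (const b) u) ⟨
      lowSum u + ∑[ w < n ] hitSum (const b) u w                   ≡⟨ ∑-distrib-+ (λ w → lowAt (adj? u w)) _ ⟨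
      ∑[ w < n ] (lowAt (adj? u w) + hitSum (const b) u w)         ≤⟨ sum-mono (lowAt-bound u) ⟩
      ∑[ w < n ] (𝟙 (adj? u w) * b)                                ≡⟨ *-distribʳ-sum b (λ w → 𝟙 (adj? u w)) ⟨
      degree G u * b                                               ∎
      where open ≤-Reasoning

    module _ (p : Fin r → Fin r) (p-injective : Injective _≡_ _≡_ p) where

      permute : Fin (b + r) → Fin (b + r)
      permute k = join b r (map₂ p (splitAt b k))

      map₂-injective : ∀ (s s′ : Fin b ⊎ Fin r) → map₂ p s ≡ map₂ p s′ → s ≡ s′
      map₂-injective (inj₁ _) (inj₁ _) refl = refl
      map₂-injective (inj₂ i) (inj₂ j) eq   = cong inj₂ (p-injective (inj₂-injective eq))

      permute-injective : Injective _≡_ _≡_ permute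
      permute-injective {k} {l} eq = begin
        k                      ≡⟨ Fin.join-splitAt b r k ⟨
        join b r (splitAt b k) ≡⟨ cong (join b r) (map₂-injective (splitAt b k) (splitAt b l) (begin
          map₂ p (splitAt b k)             ≡⟨ Fin.splitAt-join b r (map₂ p (splitAt b k)) ⟨
          splitAt b (permute k)            ≡⟨ cong (splitAt b) eq ⟩
          splitAt b (permute l)            ≡⟨ Fin.splitAt-join b r (map₂ p (splitAt b l)) ⟩
          map₂ p (splitAt b l)             ∎)) ⟩
        join b r (splitAt b l) ≡⟨ Fin.join-splitAt b r l ⟩
        l                      ∎
        where open ≡-Reasoning

      labeling : Labeling G
      labeling = labelBy G (λ d → cast (sym size≡) (permute (place d)))
        (λ d d′ same → cong (cast (sym size≡) ∘ permute) (place-cong d d′ same))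
        (λ d d′ eq → place-injective d d′ (permute-injective (cast-injective (sym size≡) eq)))

      x : Fin r → ℕ
      x i = suc (b + toℕ (p i))

      label-labeling : ∀ d → label G labeling d ≡ low d + hitSum x (src d) (tgt d)
      label-labeling d rewrite Fin.toℕ-cast (sym size≡) (permute (place d)) with splitAt b (place d) in eq
      ... | inj₁ c rewrite hitSum-low x d c eq | +-identityʳ (toℕ c) = cong suc (Fin.toℕ-↑ˡ c r)
      ... | inj₂ i rewrite hitSum-high x d i eq = cong suc (Fin.toℕ-↑ʳ b (p i))

      contribution-labeling : ∀ u w → contribution G labeling (adj? u w) ≡ lowAt (adj? u w) + hitSum x u w
      contribution-labeling u w with adj? u w
      ... | yes uw = label-labeling (dart u w uw)
      ... | no ¬uw = sym (hitSum-nonadjacent x u w ¬uw)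

      vertexSum-labeling : ∀ u → vertexSum G labeling u ≡ lowSum u + incidenceSum e x u
      vertexSum-labeling u = begin
        vertexSum G labeling u                            ≡⟨ sum-cong-≗ (contribution-labeling u) ⟩
        ∑[ w < n ] (lowAt (adj? u w) + hitSum x u w)      ≡⟨ ∑-distrib-+ (λ w → lowAt (adj? u w)) _ ⟩
        lowSum u + ∑[ w < n ] hitSum x u w                ≡⟨ cong (lowSum u +_) (∑-hitSum x u) ⟩
        lowSum u + incidenceSum e x u                     ∎
        where open ≡-Reasoning

    reservation : Reservation e
    reservation = record
      { b       = b
      ; t       = lowSum
      ; t-bound = lowSum-bound
      ; relabel = λ p p-injective → labeling p p-injective , vertexSum-labeling p p-injective
      }

  reserve : ∀ {r} (e : Fin r → Dart G) → (∀ i j → SameEdge G (e i) (e j) → i ≡ j) → Reservation e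
  reserve {r} e e-injective =
    Reserve.reservation size≡ e e-injective (φ ∘ cast size≡ ∘ index G)
      (λ d d′ same → cong (φ ∘ cast size≡) (index-cong G d d′ same))
      (λ d d′ eq → index-injective G d d′ (cast-injective size≡ (φ-injective eq)))
      φ-e
    where
    index∘e-injective : Injective _≡_ _≡_ (index G ∘ e)
    index∘e-injective {i} {j} eq = e-injective i j (index-injective G (e i) (e j) eq)

    size≡ : size G ≡ size G ∸ r + r
    size≡ = sym (m∸n+n≡m (Fin.injective⇒≤ index∘e-injective))

    extension = extend-injection (cast size≡ ∘ index G ∘ e) (size G ∸ r ↑ʳ_)
      (λ eq → index∘e-injective (cast-injective size≡ eq)) (λ {i} {j} → Fin.↑ʳ-injective (size G ∸ r) i j)

    φ = proj₁ extension
    φ-injective = proj₁ (proj₂ extension)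
    φ-e = proj₂ (proj₂ extension)

-- Distinctness of the vertex sums

sum-≥-const : ∀ {n} (f : Fin n → ℕ) {c} → (∀ i → c ≤ f i) → n * c ≤ sum f
sum-≥-const {n} f {c} h = subst (_≤ sum f) (sum-const n c) (sum-mono h)

-- Index #y stands for y, #x for x and #μ j for the neighbours of v other than y. The edges without a
-- reserved label contribute tx and ty to x and y, and A also counts a second edge at x, labelled b + 1.
-- label′ #x is the label of the edge xy, and label′ i for i ≠ #x that of the edge to v.
module Distinctness (k b tx ty : ℕ) (Q : Fin k → ℕ)
  (1≤k : 1 ≤ k) (tx≤ : tx + b ≤ k * b) (ty≤ : ty + b ≤ k * b) (Q≤ : ∀ j → Q j ≤ k * b + 1) where

  A : ℕ
  A = tx + suc b

  q′ : Fin (suc k) → ℕ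
  q′ = A ∷ Q

  -- If y precedes x then the label of x, hence the partial sum of y, is one more than q zero
  -- accounts for. As y comes last among ties, its position remains correct.
  q : Fin (suc (suc k)) → ℕ
  q = (ty + (2 + b + rank q′ zero)) ∷ q′

  pattern #y = zero
  pattern #x = suc zero
  pattern #μ j = suc (suc j)

  label′ : Fin (suc (suc k)) → ℕ
  label′ i = 2 + b + rank q i

  total : Fin (suc (suc k)) → ℕ
  total #y     = ty + (label′ #x + label′ #y)
  total #x     = A + label′ #x
  total (#μ j) = Q j + label′ (#μ j)

  hub : ℕ
  hub = label′ #y + ∑[ j < k ] label′ (#μ j)

  partial : Fin (suc (suc k)) → ℕ
  partial #y      = q #y + 𝟙 (q #y <? A)
  partial (suc i) = q (suc i)

  total≡ : ∀ i → total i ≡ partial i + label′ i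
  total≡ #y     = lemma ty b (rank q′ zero) (𝟙 (q #y <? A)) (label′ #y)
    where
    lemma : ∀ t b r d l → t + ((2 + b + (d + r)) + l) ≡ t + (2 + b + r) + d + l
    lemma = solve-∀
  total≡ #x     = refl
  total≡ (#μ j) = refl

  q-mono : ∀ i j → rank q i < rank q j → q i ≤ q j
  q-mono i j lt = ≮⇒≥ λ qj<qi → <-asym lt (rank-mono-< q j i qj<qi)

  q-mono-y : ∀ j → rank q #y < rank q (suc j) → q #y < q (suc j)
  q-mono-y j lt = ≰⇒> λ qj≤qy → [ (λ h → <-asym lt (rank-mono-< q (suc j) #y h))
                               , (λ h → <-asym lt (rank-tie q (suc j) #y h z<s)) ]′
    (m≤n⇒m<n∨m≡n qj≤qy)

  partial-mono : ∀ i j → rank q i < rank q j → partial i ≤ partial j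
  partial-mono #y      #y      lt = ≤-refl
  partial-mono #y      (suc j) lt = begin
    q #y + 𝟙 (q #y <? A)  ≤⟨ +-monoʳ-≤ (q #y) (𝟙-≤1 (q #y <? A)) ⟩
    q #y + 1              ≡⟨ +-comm (q #y) 1 ⟩
    suc (q #y)            ≤⟨ q-mono-y j lt ⟩
    q (suc j)             ∎
    where open ≤-Reasoning
  partial-mono (suc i) #y      lt = ≤-trans (q-mono (suc i) #y lt) (m≤m+n (q #y) _)
  partial-mono (suc i) (suc j) lt = q-mono (suc i) (suc j) lt

  total-mono : ∀ i j → rank q i < rank q j → total i < total j
  total-mono i j lt = begin-strict
    total i                ≡⟨ total≡ i ⟩
    partial i + label′ i   <⟨ +-mono-≤-< (partial-mono i j lt) (+-monoʳ-< (2 + b) lt) ⟩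
    partial j + label′ j   ≡⟨ total≡ j ⟨
    total j                ∎
    where open ≤-Reasoning

  total-injective : Injective _≡_ _≡_ total
  total-injective {i} {j} eq with <-cmp (rank q i) (rank q j)
  ... | tri< lt _ _ = contradiction eq (<⇒≢ (total-mono i j lt))
  ... | tri≈ _ h _  = rank-injective q {i} {j} h
  ... | tri> _ _ gt = contradiction (sym eq) (<⇒≢ (total-mono j i gt))

  hub≡ : hub ≡ suc k * (2 + b) + (rank q #y + ∑[ j < k ] rank q (#μ j))
  hub≡ = trans (∑-distrib-+ {suc k} (const (2 + b)) ρ) (cong (_+ sum ρ) (sum-const (suc k) (2 + b)))
    where
    ρ : Fin (suc k) → ℕ
    ρ = rank q ∘ Fin.punchIn #x

  hub-≥ : suc k * (2 + b) + k ≤ hub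
  hub-≥ = subst (suc k * (2 + b) + k ≤_) (sym hub≡)
    (+-monoʳ-≤ (suc k * (2 + b)) (sum-injective-≥ (rank q ∘ Fin.punchIn #x) λ {i} {j} eq →
      Fin.punchIn-injective #x i j (rank-injective q {Fin.punchIn #x i} {Fin.punchIn #x j} eq)))

  μ<hub : ∀ j → total (#μ j) < hub
  μ<hub j = begin-strict
    Q j + label′ (#μ j)             ≡⟨ +-comm (Q j) _ ⟩
    label′ (#μ j) + Q j             <⟨ +-monoʳ-< (label′ (#μ j)) Q<rest ⟩
    label′ (#μ j) + sum rest        ≡⟨ sum-remove {i = suc j} (label′ ∘ Fin.punchIn #x) ⟨
    hub                                ∎
    where
    open ≤-Reasoning
    rest : Fin k → ℕ
    rest = label′ ∘ Fin.punchIn #x ∘ Fin.punchIn (suc j)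
    Q<rest : Q j < sum rest
    Q<rest = begin-strict
      Q j          ≤⟨ Q≤ j ⟩
      k * b + 1    <⟨ +-monoʳ-< (k * b) (*-monoˡ-≤ 2 1≤k) ⟩
      k * b + k * 2 ≡⟨ lemma k b ⟩
      k * (2 + b)  ≤⟨ sum-≥-const rest (λ i → m≤m+n (2 + b) _) ⟩
      sum rest     ∎
      where
      lemma : ∀ k b → k * b + k * 2 ≡ k * (2 + b)
      lemma = solve-∀

  x<hub : total #x < hub
  x<hub = ≤-trans (bound k 1≤k tx≤ refl) hub-≥
    where
    open ≤-Reasoning
    lemma : ∀ t b r → t + suc b + (2 + b + r) ≡ (t + b) + (3 + b + r)
    lemma = solve-∀
    bound : ∀ m → 1 ≤ m → tx + b ≤ m * b → m ≡ k → A + label′ #x < suc m * (2 + b) + m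
    bound 1 _ tx≤ refl = begin-strict
      A + label′ #x                 ≡⟨ lemma tx b (rank q #x) ⟩
      (tx + b) + (3 + b + rank q #x) <⟨ +-mono-≤-< tx≤ (+-monoʳ-< (3 + b) (<-≤-trans x<y (s≤s⁻¹ (rank< q #y)))) ⟩
      1 * b + (3 + b + 2)          ≡⟨ lemma′ b ⟩
      2 * (2 + b) + 1              ∎
      where
      lemma′ : ∀ b → 1 * b + (3 + b + 2) ≡ 2 * (2 + b) + 1
      lemma′ = solve-∀
      x<y : rank q #x < rank q #y
      x<y = rank-mono-< q #x #y (begin-strict
        tx + suc b                        ≡⟨ +-suc tx b ⟩
        suc (tx + b)                      ≤⟨ s≤s tx≤ ⟩
        suc (1 * b)                       ≡⟨ cong suc (*-identityˡ b) ⟩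
        suc b                             <⟨ ≤-refl ⟩
        2 + b                             ≤⟨ m≤m+n (2 + b) (rank q′ zero) ⟩
        2 + b + rank q′ zero              ≤⟨ m≤n+m _ ty ⟩
        ty + (2 + b + rank q′ zero)       ∎)
    bound (suc (suc m)) _ tx≤ refl = begin-strict
      A + label′ #x                     ≡⟨ lemma tx b (rank q #x) ⟩
      (tx + b) + (3 + b + rank q #x)    ≤⟨ +-mono-≤ tx≤ (+-monoʳ-≤ (3 + b) (s≤s⁻¹ (rank< q #x))) ⟩
      k * b + (3 + b + suc k)          <⟨ m<m+n _ z<s ⟩
      k * b + (3 + b + suc k) + suc (suc (2 * m)) ≡⟨ lemma′ m b ⟩
      suc k * (2 + b) + k              ∎
      where
      lemma′ : ∀ m b → suc (suc m) * b + (3 + b + suc (suc (suc m))) + suc (suc (2 * m)) ≡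
                       suc (suc (suc m)) * (2 + b) + suc (suc m)
      lemma′ = solve-∀

  y≢hub : total #y ≢ hub
  y≢hub with <-cmp (rank q #y) (rank q #x)
  ... | tri< y<x _ _ = <⇒≢ (<-trans (total-mono #y #x y<x) x<hub)
  ... | tri≈ _ eq _  = contradiction (rank-injective q {#y} {#x} eq) λ ()
  ... | tri> _ _ x<y = λ eq → bound k 1≤k refl ty≤
          (+-cancelˡ-≡ (label′ #y) _ _ (trans (sym (rotate ty (label′ #x) (label′ #y))) eq))
    where
    rotate : ∀ t l m → t + (l + m) ≡ m + (t + l)
    rotate = solve-∀
    open ≤-Reasoning
    bound : ∀ m → 1 ≤ m → m ≡ k → ty + b ≤ m * b → ty + label′ #x ≢ ∑[ j < k ] label′ (#μ j)
    bound 1 _ refl ty≤ eq = contradiction (rank-injective q {#x} {#μ zero} (+-cancelˡ-≡ (2 + b) _ _ x≡μ)) λ ()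
      where
      ty≡0 : ty ≡ 0
      ty≡0 = n≤0⇒n≡0 (+-cancelʳ-≤ b ty 0 (subst (ty + b ≤_) (*-identityˡ b) ty≤))
      x≡μ : label′ #x ≡ label′ (#μ zero)
      x≡μ = trans (cong (_+ label′ #x) (sym ty≡0)) (trans eq (+-identityʳ _))
    bound (suc (suc m)) _ refl ty≤ = <⇒≢ (begin-strict
      ty + label′ #x                      ≡⟨ lemma ty b (rank q #x) ⟩
      (ty + b) + (2 + rank q #x)          ≤⟨ +-mono-≤ ty≤ (+-monoʳ-≤ 2 (s≤s⁻¹ (<-≤-trans x<y (s≤s⁻¹ (rank< q #y))))) ⟩
      k * b + (2 + k)                     <⟨ m<m+n _ z<s ⟩
      k * b + (2 + k) + suc (2 * m)       ≡⟨ lemma′ m b ⟩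
      k * (2 + b) + suc m                 ≤⟨ +-monoʳ-≤ (k * (2 + b)) (sum-injective-≥ (rank q ∘ μᵢ)
                                               λ {i} {j} eq → μᵢ-injective (rank-injective q {#μ i} {#μ j} eq)) ⟩
      k * (2 + b) + ∑[ j < k ] rank q (#μ j) ≡⟨ cong (_+ ∑[ j < k ] rank q (#μ j)) (sum-const k (2 + b)) ⟨
      sum {k} (const (2 + b)) + ∑[ j < k ] rank q (#μ j) ≡⟨ ∑-distrib-+ {k} (const (2 + b)) (λ j → rank q (#μ j)) ⟨
      ∑[ j < k ] label′ (#μ j)            ∎)
      where
      μᵢ : Fin k → Fin (suc (suc k))
      μᵢ j = #μ j
      μᵢ-injective : ∀ {i j} → (Fin (suc (suc k)) ∋ #μ i) ≡ #μ j → i ≡ j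
      μᵢ-injective refl = refl
      lemma : ∀ t b r → t + (2 + b + r) ≡ (t + b) + (2 + r)
      lemma = solve-∀
      lemma′ : ∀ m b → suc (suc m) * b + (2 + suc (suc m)) + suc (2 * m) ≡ suc (suc m) * (2 + b) + suc m
      lemma′ = solve-∀

  total≢hub : ∀ i → total i ≢ hub
  total≢hub #y     = y≢hub
  total≢hub #x     = <⇒≢ x<hub
  total≢hub (#μ j) = <⇒≢ (μ<hub j)

-- A vertex of degree n - 2 and its non-neighbour

foldr-⊔-attained : ∀ {n} (f : Fin (suc n) → ℕ) → ∃ λ i → f i ≡ foldr _⊔_ 0 f
foldr-⊔-attained {zero}  f = zero , sym (⊔-identityʳ (f zero))
foldr-⊔-attained {suc n} f with foldr-⊔-attained (f ∘ suc) | ⊔-sel (f zero) (foldr _⊔_ 0 (f ∘ suc))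
... | _      | inj₁ eq = zero , sym eq
... | i , fi | inj₂ eq = suc i , trans fi (sym eq)

≤-foldr-⊔ : ∀ {n} (f : Fin n → ℕ) i → f i ≤ foldr _⊔_ 0 f
≤-foldr-⊔ f zero    = m≤m⊔n (f zero) _
≤-foldr-⊔ f (suc i) = ≤-trans (≤-foldr-⊔ (f ∘ suc) i) (m≤n⊔m (f zero) _)

count-all : ∀ {n} {P : Fin n → Set} (P? : ∀ i → Dec (P i)) → n ≤ ∑[ i < n ] 𝟙 (P? i) → ∀ i → P i
count-all {suc n} P? n≤ i with P? i in eq
... | yes p = p
... | no _  = contradiction n≤ (<⇒≱ (begin-strict
  ∑[ j < suc n ] 𝟙 (P? j)                        ≡⟨ sum-remove {i = i} (λ j → 𝟙 (P? j)) ⟩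
  𝟙 (P? i) + ∑[ j < n ] 𝟙 (P? (punchIn i j))     ≡⟨ cong (λ d → 𝟙 d + ∑[ j < n ] 𝟙 (P? (punchIn i j))) eq ⟩
  ∑[ j < n ] 𝟙 (P? (punchIn i j))                ≤⟨ sum-mono (λ j → 𝟙-≤1 (P? (punchIn i j))) ⟩
  sum {n} (const 1)                              ≡⟨ trans (sum-const n 1) (*-identityʳ n) ⟩
  n                                              <⟨ n<1+n n ⟩
  suc n                                          ∎))
  where open ≤-Reasoning

count-all-but-one : ∀ {n} {P : Fin (suc n) → Set} (P? : ∀ i → Dec (P i)) → ∑[ i < suc n ] 𝟙 (P? i) ≡ n →
                    ∃ λ i → ¬ P i × (∀ j → P (punchIn i j))
count-all-but-one {n} {P} P? eq with Fin.any? (λ i → ¬? (P? i))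
... | no none = contradiction (begin-strict
  n                            <⟨ n<1+n n ⟩
  suc n                        ≡⟨ trans (sum-const (suc n) 1) (*-identityʳ (suc n)) ⟨
  sum {suc n} (const 1)        ≤⟨ sum-mono (λ i → ≤-reflexive (sym (𝟙-true (P? i)
                                    (decidable-stable (P? i) λ ¬p → none (i , ¬p))))) ⟩
  ∑[ i < suc n ] 𝟙 (P? i)      ≡⟨ eq ⟩
  n                            ∎) (<-irrefl refl)
  where open ≤-Reasoning
... | yes (i , ¬p) = i , ¬p , count-all (P? ∘ punchIn i) (≤-reflexive (begin
  n                                              ≡⟨ eq ⟨
  ∑[ j < suc n ] 𝟙 (P? j)                        ≡⟨ sum-remove {i = i} (λ j → 𝟙 (P? j)) ⟩
  𝟙 (P? i) + ∑[ j < n ] 𝟙 (P? (punchIn i j))     ≡⟨ cong (_+ ∑[ j < n ] 𝟙 (P? (punchIn i j))) (𝟙-false (P? i) ¬p) ⟩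
  ∑[ j < n ] 𝟙 (P? (punchIn i j))                ∎))
  where open ≡-Reasoning

punchIn-cover : ∀ {n} (i j : Fin (suc n)) → j ≡ i ⊎ ∃ λ l → j ≡ punchIn i l
punchIn-cover i j with i ≟ j
... | yes i≡j = inj₁ (sym i≡j)
... | no  i≢j = inj₂ (punchOut i≢j , sym (Fin.punchIn-punchOut i≢j))

module _ {n : ℕ} where

  star : ∀ {m} → (Fin m → Fin n) → Fin n → (Fin m → ℕ) → Fin n → ℕ
  star {m} μ v z u = ∑[ j < m ] ((𝟙 (μ j ≟ u) + 𝟙 (v ≟ u)) * z j)

  module _ {m} (μ : Fin m → Fin n) (v : Fin n) (z : Fin m → ℕ) where

    star-away : ∀ {u} → v ≢ u → (∀ j → μ j ≢ u) → star μ v z u ≡ 0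
    star-away {u} v≢u μ≢u = sum-zero λ j → cong₂ (λ a c → (a + c) * z j) (𝟙-false (μ j ≟ u) (μ≢u j)) (𝟙-false (v ≟ u) v≢u)

    star-hub : (∀ j → v ≢ μ j) → star μ v z v ≡ sum z
    star-hub v≢μ = sum-cong-≗ λ j →
      trans (cong₂ (λ a c → (a + c) * z j) (𝟙-false (μ j ≟ v) (v≢μ j ∘ sym)) (𝟙-true (v ≟ v) refl)) (*-identityˡ (z j))

    star-leaf : (∀ j → v ≢ μ j) → Injective _≡_ _≡_ μ → ∀ j → star μ v z (μ j) ≡ z j
    star-leaf v≢μ μ-injective j = trans
      (sum-single j λ i i≢j → cong₂ (λ a c → (a + c) * z i)
        (𝟙-false (μ i ≟ μ j) (i≢j ∘ μ-injective)) (𝟙-false (v ≟ μ j) (v≢μ j)))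
      (trans (cong₂ (λ a c → (a + c) * z j) (𝟙-true (μ j ≟ μ j) refl) (𝟙-false (v ≟ μ j) (v≢μ j))) (*-identityˡ (z j)))

  injective-on-cover : ∀ {m} (S : Fin n → ℕ) v (κ : Fin m → Fin n) (F : Fin m → ℕ) →
                       (∀ u → u ≡ v ⊎ ∃ λ i → u ≡ κ i) → (∀ i → S (κ i) ≡ F i) →
                       Injective _≡_ _≡_ F → (∀ i → F i ≢ S v) → Injective _≡_ _≡_ S
  injective-on-cover S v κ F cover S≡F F-injective F≢ {u} {w} eq with cover u | cover w
  ... | inj₁ refl       | inj₁ refl       = refl
  ... | inj₁ refl       | inj₂ (i , refl) = contradiction (trans (sym (S≡F i)) (sym eq)) (F≢ i)
  ... | inj₂ (i , refl) | inj₁ refl       = contradiction (trans (sym (S≡F i)) eq) (F≢ i)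
  ... | inj₂ (i , refl) | inj₂ (j , refl) = cong κ (F-injective (trans (sym (S≡F i)) (trans eq (S≡F j))))

rankPermutation : ∀ {r} → (Fin r → ℕ) → Fin r → Fin r
rankPermutation q i = fromℕ< (rank< q i)

rankPermutation-injective : ∀ {r} (q : Fin r → ℕ) → Injective _≡_ _≡_ (rankPermutation q)
rankPermutation-injective q {i} {j} eq =
  rank-injective q {i} {j} (Fin.fromℕ<-injective (rank q i) (rank q j) (rank< q i) (rank< q j) eq)

module Pendant {n k} (G : Graph n) (v x : Fin n) (ν : Fin (suc k) → Fin n)
  (1≤k : 1 ≤ k) (v≢x : v ≢ x) (v≢ν : ∀ j → v ≢ ν j) (x≢ν : ∀ j → x ≢ ν j) (ν-injective : Injective _≡_ _≡_ ν)
  (cover : ∀ u → u ≡ v ⊎ ∃ λ i → u ≡ (x ∷ ν) i)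
  (ν~v : ∀ j → Graph.Adj G (ν j) v)
  (degree≤ : ∀ u → degree G u ≤ suc k) (degree-x≤1 : degree G x ≤ 1)
  where

  e : Fin (suc k) → Dart G
  e j = dart (ν j) v (ν~v j)

  e-injective : ∀ i j → SameEdge G (e i) (e j) → i ≡ j
  e-injective i j (inj₁ (p , _)) = ν-injective p
  e-injective i j (inj₂ (_ , q)) = contradiction q (v≢ν j)

  module _ (R : Reservation G e) where
    open Reservation R

    q : Fin (suc k) → ℕ
    q = t ∘ ν

    lab : Fin (suc k) → ℕ
    lab j = suc (b + rank q j)

    total : Fin (suc (suc k)) → ℕ
    total zero    = t x
    total (suc j) = q j + lab j

    t-leaf : ∀ j → q j ≤ k * b
    t-leaf j = +-cancelʳ-≤ b (q j) (k * b) (begin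
      q j + b                                  ≡⟨ cong (q j +_) (star-leaf ν v (const b) v≢ν ν-injective j) ⟨
      q j + incidenceSum G e (const b) (ν j)   ≤⟨ t-bound (ν j) ⟩
      degree G (ν j) * b                       ≤⟨ *-monoˡ-≤ b (degree≤ (ν j)) ⟩
      suc k * b                                ≡⟨ +-comm b (k * b) ⟩
      k * b + b                                ∎)
      where open ≤-Reasoning

    t-x : t x ≤ b
    t-x = begin
      t x                                      ≤⟨ m≤m+n (t x) _ ⟩
      t x + incidenceSum G e (const b) x       ≤⟨ t-bound x ⟩
      degree G x * b                           ≤⟨ *-monoˡ-≤ b degree-x≤1 ⟩
      1 * b                                    ≡⟨ *-identityˡ b ⟩
      b                                        ∎
      where open ≤-Reasoning

    b<lab : ∀ j → b < lab j
    b<lab j = s≤s (m≤m+n b (rank q j))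

    x<leaf : ∀ j → total zero < total (suc j)
    x<leaf j = ≤-<-trans t-x (<-≤-trans (b<lab j) (m≤n+m (lab j) (q j)))

    leaf<sum : ∀ j → total (suc j) < sum lab
    leaf<sum j = begin-strict
      q j + lab j          ≡⟨ +-comm (q j) (lab j) ⟩
      lab j + q j          ≤⟨ +-monoʳ-≤ (lab j) (t-leaf j) ⟩
      lab j + k * b        <⟨ +-monoʳ-< (lab j) (*-monoʳ-< k {{>-nonZero 1≤k}} (n<1+n b)) ⟩
      lab j + k * suc b    ≤⟨ +-monoʳ-≤ (lab j) (sum-≥-const (lab ∘ punchIn j) (b<lab ∘ punchIn j)) ⟩
      lab j + sum (lab ∘ punchIn j) ≡⟨ sum-remove {i = j} lab ⟨
      sum lab              ∎
      where open ≤-Reasoning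

    total<sum : ∀ i → total i < sum lab
    total<sum zero    = <-trans (x<leaf zero) (leaf<sum zero)
    total<sum (suc j) = leaf<sum j

    total-injective : Injective _≡_ _≡_ total
    total-injective {zero}  {zero}  eq = refl
    total-injective {zero}  {suc j} eq = contradiction eq (<⇒≢ (x<leaf j))
    total-injective {suc i} {zero}  eq = contradiction (sym eq) (<⇒≢ (x<leaf i))
    total-injective {suc i} {suc j} eq with i ≟ j
    ... | yes i≡j = cong suc i≡j
    ... | no i≢j with rank-compare q i≢j
    ...   | inj₁ (qi≤qj , lt) = contradiction eq (<⇒≢ (+-mono-≤-< qi≤qj (s<s (+-monoʳ-< b lt))))
    ...   | inj₂ (qj≤qi , gt) = contradiction (sym eq) (<⇒≢ (+-mono-≤-< qj≤qi (s<s (+-monoʳ-< b gt))))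

    antimagic′ : Antimagic G
    antimagic′ = f , injective-on-cover (vertexSum G f) v (x ∷ ν) total cover at-κ total-injective
      λ i → <⇒≢ (<-≤-trans (total<sum i) (subst (sum lab ≤_) (sym at-v) (m≤n+m (sum lab) (t v))))
      where
      relabeled = relabel (rankPermutation q) (rankPermutation-injective q)
      f = proj₁ relabeled
      sums : ∀ u → vertexSum G f u ≡ t u + star ν v lab u
      sums u = trans (proj₂ relabeled u) (cong (t u +_) (sum-cong-≗ λ j →
        cong (λ l → (𝟙 (ν j ≟ u) + 𝟙 (v ≟ u)) * suc (b + l)) (Fin.toℕ-fromℕ< (rank< q j))))
      at-v : vertexSum G f v ≡ t v + sum lab
      at-v = trans (sums v) (cong (t v +_) (star-hub ν v lab v≢ν))
      at-κ : ∀ i → vertexSum G f ((x ∷ ν) i) ≡ total i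
      at-κ zero    = trans (sums x) (trans (cong (t x +_) (star-away ν v lab v≢x (λ j → x≢ν j ∘ sym))) (+-identityʳ (t x)))
      at-κ (suc j) = trans (sums (ν j)) (cong (t (ν j) +_) (star-leaf ν v lab v≢ν ν-injective j))

  antimagic : Antimagic G
  antimagic = antimagic′ (reserve G e e-injective)

module Branching {n k} (G : Graph n) (v x y : Fin n) (μ : Fin k → Fin n) (m : Fin k)
  (v≢x : v ≢ x) (v≢y : v ≢ y) (x≢y : x ≢ y)
  (v≢μ : ∀ j → v ≢ μ j) (x≢μ : ∀ j → x ≢ μ j) (y≢μ : ∀ j → y ≢ μ j) (μ-injective : Injective _≡_ _≡_ μ)
  (cover : ∀ u → u ≡ v ⊎ ∃ λ i → u ≡ (y ∷ x ∷ μ) i)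
  (μ~v : ∀ j → Graph.Adj G (μ j) v) (y~v : Graph.Adj G y v) (x~y : Graph.Adj G x y) (x~μ : Graph.Adj G x (μ m))
  (degree-v : degree G v ≡ suc k) (degree≤ : ∀ u → degree G u ≤ suc k)
  where

  e : Fin (suc (suc (suc k))) → Dart G
  e zero                = dart x (μ m) x~μ
  e (suc zero)          = dart y v y~v
  e (suc (suc zero))    = dart x y x~y
  e (suc (suc (suc j))) = dart (μ j) v (μ~v j)

  e-injective : ∀ i j → SameEdge G (e i) (e j) → i ≡ j
  e-injective zero zero _ = refl
  e-injective zero (suc zero) (inj₁ (p , _)) = contradiction p x≢y
  e-injective zero (suc zero) (inj₂ (p , _)) = contradiction (sym p) v≢x
  e-injective zero (suc (suc zero)) (inj₁ (_ , q)) = contradiction (sym q) (y≢μ m)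
  e-injective zero (suc (suc zero)) (inj₂ (p , _)) = contradiction p x≢y
  e-injective zero (suc (suc (suc j))) (inj₁ (p , _)) = contradiction p (x≢μ j)
  e-injective zero (suc (suc (suc j))) (inj₂ (p , _)) = contradiction (sym p) v≢x
  e-injective (suc zero) zero (inj₁ (p , _)) = contradiction (sym p) x≢y
  e-injective (suc zero) zero (inj₂ (_ , q)) = contradiction q v≢x
  e-injective (suc zero) (suc zero) _ = refl
  e-injective (suc zero) (suc (suc zero)) (inj₁ (p , _)) = contradiction (sym p) x≢y
  e-injective (suc zero) (suc (suc zero)) (inj₂ (_ , q)) = contradiction q v≢x
  e-injective (suc zero) (suc (suc (suc j))) (inj₁ (p , _)) = contradiction p (y≢μ j)
  e-injective (suc zero) (suc (suc (suc j))) (inj₂ (p , _)) = contradiction (sym p) v≢y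
  e-injective (suc (suc zero)) zero (inj₁ (_ , q)) = contradiction q (y≢μ m)
  e-injective (suc (suc zero)) zero (inj₂ (_ , q)) = contradiction (sym q) x≢y
  e-injective (suc (suc zero)) (suc zero) (inj₁ (p , _)) = contradiction p x≢y
  e-injective (suc (suc zero)) (suc zero) (inj₂ (p , _)) = contradiction (sym p) v≢x
  e-injective (suc (suc zero)) (suc (suc zero)) _ = refl
  e-injective (suc (suc zero)) (suc (suc (suc j))) (inj₁ (p , _)) = contradiction p (x≢μ j)
  e-injective (suc (suc zero)) (suc (suc (suc j))) (inj₂ (p , _)) = contradiction (sym p) v≢x
  e-injective (suc (suc (suc i))) zero (inj₁ (p , _)) = contradiction (sym p) (x≢μ i)
  e-injective (suc (suc (suc i))) zero (inj₂ (_ , q)) = contradiction q v≢x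
  e-injective (suc (suc (suc i))) (suc zero) (inj₁ (p , _)) = contradiction (sym p) (y≢μ i)
  e-injective (suc (suc (suc i))) (suc zero) (inj₂ (_ , q)) = contradiction q v≢y
  e-injective (suc (suc (suc i))) (suc (suc zero)) (inj₁ (p , _)) = contradiction (sym p) (x≢μ i)
  e-injective (suc (suc (suc i))) (suc (suc zero)) (inj₂ (_ , q)) = contradiction q v≢x
  e-injective (suc (suc (suc i))) (suc (suc (suc j))) (inj₁ (p , _)) = cong (λ l → suc (suc (suc l))) (μ-injective p)
  e-injective (suc (suc (suc i))) (suc (suc (suc j))) (inj₂ (_ , q)) = contradiction q (v≢μ j)

  module _ (R : Reservation G e) where
    open Reservation R

    module _ (z : Fin (suc (suc (suc k))) → ℕ) where

      private
        z₀ = z zero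
        z₁ = z (suc zero)
        z₂ = z (suc (suc zero))
        z₃ : Fin k → ℕ
        z₃ j = z (suc (suc (suc j)))

      incidence-v : incidenceSum G e z v ≡ z₁ + sum z₃
      incidence-v rewrite 𝟙-false (x ≟ v) (v≢x ∘ sym) | 𝟙-false (μ m ≟ v) (v≢μ m ∘ sym)
                        | 𝟙-false (y ≟ v) (v≢y ∘ sym) | star-hub μ v z₃ v≢μ | 𝟙-true (v ≟ v) refl
                        = cong (_+ sum z₃) (*-identityˡ z₁)

      incidence-x : incidenceSum G e z x ≡ z₀ + z₂
      incidence-x rewrite 𝟙-true (x ≟ x) refl | 𝟙-false (μ m ≟ x) (x≢μ m ∘ sym) | 𝟙-false (y ≟ x) (x≢y ∘ sym)
                        | star-away μ v z₃ v≢x (λ j → x≢μ j ∘ sym) | 𝟙-false (v ≟ x) v≢x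
                        = cong₂ _+_ (*-identityˡ z₀) (trans (+-identityʳ (1 * z₂)) (*-identityˡ z₂))

      incidence-y : incidenceSum G e z y ≡ z₁ + z₂
      incidence-y rewrite 𝟙-false (x ≟ y) x≢y | 𝟙-false (μ m ≟ y) (y≢μ m ∘ sym) | 𝟙-true (y ≟ y) refl
                        | star-away μ v z₃ v≢y (λ j → y≢μ j ∘ sym) | 𝟙-false (v ≟ y) v≢y
                        = cong₂ _+_ (*-identityˡ z₁) (trans (+-identityʳ (1 * z₂)) (*-identityˡ z₂))

      incidence-μ : ∀ j → incidenceSum G e z (μ j) ≡ 𝟙 (μ m ≟ μ j) * z₀ + z₃ j
      incidence-μ j rewrite 𝟙-false (x ≟ μ j) (x≢μ j) | 𝟙-false (y ≟ μ j) (y≢μ j)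
                        | star-leaf μ v z₃ v≢μ μ-injective j | 𝟙-false (v ≟ μ j) (v≢μ j) = refl

    bound : ∀ u → t u + incidenceSum G e (const b) u ≤ k * b + b
    bound u = begin
      t u + incidenceSum G e (const b) u  ≤⟨ t-bound u ⟩
      degree G u * b                      ≤⟨ *-monoˡ-≤ b (degree≤ u) ⟩
      suc k * b                           ≡⟨ +-comm b (k * b) ⟩
      k * b + b                           ∎
      where open ≤-Reasoning

    tx≤ : t x + b ≤ k * b
    tx≤ = +-cancelʳ-≤ b (t x + b) (k * b)
      (subst (_≤ k * b + b) (trans (cong (t x +_) (incidence-x (const b))) (sym (+-assoc (t x) b b))) (bound x))

    ty≤ : t y + b ≤ k * b
    ty≤ = +-cancelʳ-≤ b (t y + b) (k * b)
      (subst (_≤ k * b + b) (trans (cong (t y +_) (incidence-y (const b))) (sym (+-assoc (t y) b b))) (bound y))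

    tv≡0 : t v ≡ 0
    tv≡0 = n≤0⇒n≡0 (+-cancelʳ-≤ (suc k * b) (t v) 0 (begin
      t v + suc k * b                      ≡⟨ cong (λ s → t v + (b + s)) (sum-const k b) ⟨
      t v + (b + sum {k} (const b))        ≡⟨ cong (t v +_) (incidence-v (const b)) ⟨
      t v + incidenceSum G e (const b) v   ≤⟨ t-bound v ⟩
      degree G v * b                       ≡⟨ cong (_* b) degree-v ⟩
      suc k * b                            ∎))
      where open ≤-Reasoning

    Q : Fin k → ℕ
    Q j = t (μ j) + 𝟙 (μ m ≟ μ j) * suc b

    Q≤ : ∀ j → Q j ≤ k * b + 1
    Q≤ j = begin
      t (μ j) + δ * suc b          ≡⟨ lemma (t (μ j)) δ b ⟩
      t (μ j) + δ * b + δ          ≤⟨ +-mono-≤ low (𝟙-≤1 (μ m ≟ μ j)) ⟩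
      k * b + 1                    ∎
      where
      open ≤-Reasoning
      δ = 𝟙 (μ m ≟ μ j)
      lemma : ∀ t d b → t + d * suc b ≡ t + d * b + d
      lemma = solve-∀
      low : t (μ j) + δ * b ≤ k * b
      low = +-cancelʳ-≤ b _ (k * b)
        (subst (_≤ k * b + b)
          (trans (cong (t (μ j) +_) (incidence-μ (const b) j)) (sym (+-assoc (t (μ j)) (δ * b) b)))
          (bound (μ j)))

    open Distinctness k b (t x) (t y) Q (≤-trans (s≤s z≤n) (Fin.toℕ<n m)) tx≤ ty≤ Q≤

    -- Giving the label b + 1 to the second edge at x leaves only labels up to b for the edges at y other
    -- than yv and xy; for k = 2 the sum of y could otherwise reach that of v.
    place : Fin (suc (suc (suc k))) → Fin (suc (suc (suc k)))
    place zero    = zero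
    place (suc i) = suc (rankPermutation q i)

    place-injective : Injective _≡_ _≡_ place
    place-injective {zero}  {zero}  eq = refl
    place-injective {suc i} {suc j} eq = cong suc (rankPermutation-injective q (Fin.suc-injective eq))

    lab : Fin (suc (suc (suc k))) → ℕ
    lab zero    = suc b
    lab (suc i) = label′ i

    antimagic′ : Antimagic G
    antimagic′ = f , injective-on-cover (vertexSum G f) v (y ∷ x ∷ μ) total cover at-κ total-injective
      λ i eq → total≢hub i (trans eq at-v)
      where
      relabeled = relabel place place-injective
      f = proj₁ relabeled
      lab≡ : ∀ i → suc (b + toℕ (place i)) ≡ lab i
      lab≡ zero    = cong suc (+-identityʳ b)
      lab≡ (suc i) = cong suc (trans (+-suc b _) (cong (λ l → suc (b + l)) (Fin.toℕ-fromℕ< (rank< q i))))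
      sums : ∀ u → vertexSum G f u ≡ t u + incidenceSum G e lab u
      sums u = trans (proj₂ relabeled u) (cong (t u +_) (sum-cong-≗ λ i →
        cong ((𝟙 (Dart.src (e i) ≟ u) + 𝟙 (Dart.tgt (e i) ≟ u)) *_) (lab≡ i)))
      at-v : vertexSum G f v ≡ hub
      at-v = trans (sums v) (cong₂ _+_ tv≡0 (incidence-v lab))
      at-κ : ∀ i → vertexSum G f ((y ∷ x ∷ μ) i) ≡ total i
      at-κ zero          = trans (sums y) (cong (t y +_) (trans (incidence-y lab) (+-comm (label′ zero) (label′ (suc zero)))))
      at-κ (suc zero)    = trans (sums x) (trans (cong (t x +_) (incidence-x lab)) (sym (+-assoc (t x) (suc b) _)))
      at-κ (suc (suc j)) = trans (sums (μ j)) (trans (cong (t (μ j) +_) (incidence-μ lab j)) (sym (+-assoc (t (μ j)) _ _)))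

  antimagic : Antimagic G
  antimagic = antimagic′ (reserve G e e-injective)

module NonNeighbour {k : ℕ} (G : Graph (suc (suc (suc k)))) (1≤k : 1 ≤ k) (v : Fin (suc (suc (suc k))))
  (degree-v : degree G v ≡ suc k) (degree≤ : ∀ u → degree G u ≤ suc k)
  (x′ : Fin (suc (suc k))) (v≁x : ¬ Graph.Adj G v (punchIn v x′))
  (v~ν : ∀ j → Graph.Adj G v (punchIn v (punchIn x′ j)))
  where

  open Graph G renaming (sym to Adj-sym)

  x : Fin (suc (suc (suc k)))
  x = punchIn v x′

  ν : Fin (suc k) → Fin (suc (suc (suc k)))
  ν j = punchIn v (punchIn x′ j)

  v≢x : v ≢ x
  v≢x eq = Fin.punchInᵢ≢i v _ (sym eq)

  v≢ν : ∀ j → v ≢ ν j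
  v≢ν j eq = Fin.punchInᵢ≢i v _ (sym eq)

  x≢ν : ∀ j → x ≢ ν j
  x≢ν j eq = Fin.punchInᵢ≢i x′ j (sym (Fin.punchIn-injective v _ _ eq))

  ν-injective : Injective _≡_ _≡_ ν
  ν-injective {i} {j} eq = Fin.punchIn-injective x′ i j (Fin.punchIn-injective v _ _ eq)

  ν~v : ∀ j → Adj (ν j) v
  ν~v j = Adj-sym (v~ν j)

  cover : ∀ u → u ≡ v ⊎ ∃ λ i → u ≡ (x ∷ ν) i
  cover u with punchIn-cover v u
  ... | inj₁ u≡v = inj₁ u≡v
  ... | inj₂ (i , refl) with punchIn-cover x′ i
  ...   | inj₁ refl       = inj₂ (zero , refl)
  ...   | inj₂ (j , refl) = inj₂ (suc j , refl)

  degree-x : degree G x ≡ ∑[ j < suc k ] 𝟙 (adj? x (ν j))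
  degree-x = begin
    degree G x
      ≡⟨ sum-remove {i = v} (λ w → 𝟙 (adj? x w)) ⟩
    𝟙 (adj? x v) + ∑[ i < suc (suc k) ] 𝟙 (adj? x (punchIn v i))
      ≡⟨ cong₂ _+_ (𝟙-false (adj? x v) (v≁x ∘ Adj-sym))
           (sum-remove {i = x′} (λ i → 𝟙 (adj? x (punchIn v i)))) ⟩
    𝟙 (adj? x x) + ∑[ j < suc k ] 𝟙 (adj? x (ν j))
      ≡⟨ cong (_+ ∑[ j < suc k ] 𝟙 (adj? x (ν j))) (𝟙-false (adj? x x) (irrefl refl)) ⟩
    ∑[ j < suc k ] 𝟙 (adj? x (ν j)) ∎
    where open ≡-Reasoning

  module TwoNeighbours (c : Fin (suc k)) (x~y : Adj x (ν c)) (m : Fin k) (x~μ : Adj x (ν (punchIn c m))) where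

    μ : Fin k → Fin (suc (suc (suc k)))
    μ = ν ∘ punchIn c

    cover′ : ∀ u → u ≡ v ⊎ ∃ λ i → u ≡ (ν c ∷ x ∷ μ) i
    cover′ u with cover u
    ... | inj₁ u≡v           = inj₁ u≡v
    ... | inj₂ (zero  , u≡x) = inj₂ (suc zero , u≡x)
    ... | inj₂ (suc j , refl) with punchIn-cover c j
    ...   | inj₁ refl       = inj₂ (zero , refl)
    ...   | inj₂ (l , refl) = inj₂ (suc (suc l) , refl)

    antimagic : Antimagic G
    antimagic = Branching.antimagic G v x (ν c) μ m v≢x (v≢ν c) (x≢ν c) (v≢ν ∘ punchIn c) (x≢ν ∘ punchIn c)
      (λ j eq → Fin.punchInᵢ≢i c j (sym (ν-injective eq))) (λ {i} {j} eq → Fin.punchIn-injective c i j (ν-injective eq))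
      cover′ (ν~v ∘ punchIn c) (ν~v c) x~y x~μ degree-v degree≤

  twoNeighbours : 1 < ∑[ j < suc k ] 𝟙 (adj? x (ν j)) →
                  ∃ λ c → Adj x (ν c) × ∃ λ m → Adj x (ν (punchIn c m))
  twoNeighbours 1<∑ =
    let c , x~c = sum-pos (λ j → 𝟙 (adj? x (ν j))) (<⇒≤ 1<∑)
        m , x~m = sum-pos (λ j → 𝟙 (adj? x (ν (punchIn c j)))) (+-cancelˡ-≤ 1 1 _ (begin
          2                                                            ≤⟨ 1<∑ ⟩
          ∑[ j < suc k ] 𝟙 (adj? x (ν j))                              ≡⟨ sum-remove {i = c} (λ j → 𝟙 (adj? x (ν j))) ⟩
          𝟙 (adj? x (ν c)) + ∑[ j < k ] 𝟙 (adj? x (ν (punchIn c j)))   ≤⟨ +-monoˡ-≤ _ (𝟙-≤1 (adj? x (ν c))) ⟩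
          1 + ∑[ j < k ] 𝟙 (adj? x (ν (punchIn c j)))                  ∎))
    in c , 𝟙-witness (adj? x (ν c)) x~c , m , 𝟙-witness (adj? x (ν (punchIn c m))) x~m
    where open ≤-Reasoning

  antimagic : Antimagic G
  antimagic with ≤-<-connex (degree G x) 1
  ... | inj₁ d≤1 = Pendant.antimagic G v x ν 1≤k v≢x v≢ν x≢ν ν-injective cover ν~v degree≤ d≤1
  ... | inj₂ 1<d = let c , x~c , m , x~m = twoNeighbours (subst (1 <_) degree-x 1<d) in
                   TwoNeighbours.antimagic c x~c m x~m

maxDegree-antimagic : ∀ {k} (G : Graph (suc (suc (suc k)))) → 1 ≤ k → maxDegree G ≡ suc k → Antimagic G
maxDegree-antimagic {k} G 1≤k maxDegree≡ with foldr-⊔-attained (degree G)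
... | v , v-max = let x′ , v≁x , v~ν = count-all-but-one (λ i → adj? v (punchIn v i)) neighbours in
  NonNeighbour.antimagic G 1≤k v degree-v degree≤ x′ v≁x v~ν
  where
  open Graph G using (adj?; irrefl)
  degree-v : degree G v ≡ suc k
  degree-v = trans v-max maxDegree≡
  degree≤ : ∀ u → degree G u ≤ suc k
  degree≤ u = subst (degree G u ≤_) maxDegree≡ (≤-foldr-⊔ (degree G) u)
  neighbours : ∑[ i < suc (suc k) ] 𝟙 (adj? v (punchIn v i)) ≡ suc k
  neighbours = begin
    ∑[ i < suc (suc k) ] 𝟙 (adj? v (punchIn v i))
      ≡⟨ cong (_+ ∑[ i < suc (suc k) ] 𝟙 (adj? v (punchIn v i))) (𝟙-false (adj? v v) (irrefl refl)) ⟨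
    𝟙 (adj? v v) + ∑[ i < suc (suc k) ] 𝟙 (adj? v (punchIn v i))
      ≡⟨ sum-remove {i = v} (λ w → 𝟙 (adj? v w)) ⟨
    degree G v
      ≡⟨ degree-v ⟩
    suc k ∎
    where open ≡-Reasoning

lemma4p3 : (n : ℕ) (G : Graph n) → n ≥ 4 → maxDegree G ≡ n ∸ 2 →
    size G ≥ 2 * n ∸ 4 → Antimagic G
lemma4p3 (suc (suc (suc k))) G (s≤s (s≤s (s≤s 1≤k))) maxDegree≡ _ = maxDegree-antimagic G 1≤k maxDegree≡
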